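{- Every computable graph $G$ has a computable copy (a computable graph isomorphic to $G$) in which the set of universal vertices is computable.
   Context: A graph is a set of vertices $V\subseteq\mathbb{N}$ with an irreflexive symmetric edge relation; it is computable if $V$ and the edge relation are computable. A vertex $x$ is universal if it is adjacent to every vertex $y\neq x$. -}

module Defs where

open import Data.Nat using (ℕ)
open import Data.Bool using (Bool; true; false)
open import Data.Product using (Σ; _×_; ∃)
open import Relation.Binary.PropositionalEquality using (_≡_; _≢_)
open import Relation.Nullary using (¬_)
open import Function.Bundles using (_⇔_)

-- A computable graph: the vertex set V ⊆ ℕ and the edge relation are given by
-- (total, hence computable) Agda functions into Bool, i.e. their characteristic
-- functions.
record CompGraph : Set where
  field
    V     : ℕ → Bool
    E     : ℕ → ℕ → Bool
    irrefl : ∀ x → E x x ≡ false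
    sym    : ∀ x y → E x y ≡ E y x
open CompGraph public

_∈V_ : ℕ → CompGraph → Set
x ∈V G = V G x ≡ true

Adj : CompGraph → ℕ → ℕ → Set
Adj G x y = E G x y ≡ true

Universal : CompGraph → ℕ → Set
Universal G x = x ∈V G × (∀ y → y ∈V G → y ≢ x → Adj G x y)

¬¬Σ : (A : Set) → (A → Set) → Set
¬¬Σ A P = ¬ ¬ Σ A P

-- R ⊆ ℕ × ℕ is (the graph of) an isomorphism between G and H.
-- The isomorphism is NOT required to be computable, so it is given as an
-- arbitrary relation with classical totality/surjectivity.
record IsIso (G H : CompGraph) (R : ℕ → ℕ → Set) : Set where
  field
    dom        : ∀ {x y} → R x y → x ∈V G × y ∈V H
    functional : ∀ {x y y'} → R x y → R x y' → y ≡ y'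
    injective  : ∀ {x x' y} → R x y → R x' y → x ≡ x'
    total      : ∀ x → x ∈V G → ¬¬Σ ℕ (λ y → R x y)
    surjective : ∀ y → y ∈V H → ¬¬Σ ℕ (λ x → R x y)
    preserves  : ∀ {x x' y y'} → R x y → R x' y' → Adj G x x' ⇔ Adj H y y'

UniversalComputable : CompGraph → Set
UniversalComputable H = Σ (ℕ → Bool) (λ u → ∀ x → (u x ≡ true) ⇔ Universal H x)

HasCopyWithComputableUniversal : CompGraph → Set₁
HasCopyWithComputableUniversal G =
  ¬ ¬ (Σ CompGraph λ H → Σ (ℕ → ℕ → Set) λ R → IsIso G H R × UniversalComputable H)

{-# OPTIONS --safe #-}
module Submission where

-- Classically, the universal vertices of G, listed in increasing order, are
-- indexed by an initial segment of ℕ (all of ℕ or some {k | k < m}), and such a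
-- segment is decidable. The copy H is a clique on that segment, joined to a copy
-- of the non-universal part of G. A vertex is non-universal iff it has a
-- non-neighbour, so coding x by the pair of x and its least non-neighbour makes
-- the vertex set of H decidable. Isomorphisms reflect universality, so the
-- universal vertices of H are exactly the clique vertices.

open import Defs
open import Level using (0ℓ)
open import Data.Bool using (Bool; true; false)
import Data.Bool as Bool
open import Data.Nat using (ℕ; zero; suc; _+_; _≤_; _<_; _≤′_; ≤′-refl; ≤′-step; z≤n; s≤s; _≟_; _<?_)
open import Data.Nat.Properties
  using ( ≤-reflexive; ≤-trans; m≤n⇒m≤1+n; m≤m+n; <-cmp; <-irrefl; ≰⇒>; ≤⇒≤′; m<1+n⇒m<n∨m≡n
        ; +-suc; +-identityʳ; suc-injective; anyUpTo?; allUpTo?)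
open import Data.Nat.Induction using (<-rec)
open import Data.Nat.InfinitelyOften using (Fin; Inf; up; witness)
open import Data.Product using (Σ; ∃; ∃₂; _×_; _,_; proj₁; proj₂)
import Data.Product as Prod
open import Data.Sum using (inj₁; inj₂)
open import Data.Unit using (⊤; tt)
open import Effect.Monad using (RawMonad)
open import Function using (_∘_)
open import Function.Bundles using (_⇔_; mk⇔; Equivalence)
open import Function.Properties.Equivalence using (⇔-setoid)
open import Function.Construct.Symmetry using (⇔-sym)
open import Relation.Binary.Definitions using (tri<; tri≈; tri>)
open import Relation.Binary.PropositionalEquality as ≡ using (_≡_; _≢_; refl; cong; trans; subst; ≢-sym)
open import Relation.Nullary using (¬_; Dec; yes; no; does; contradiction)
open import Relation.Nullary.Decidable
  using (_×-dec_; ¬?; dec-true; dec-false; does-⇔; decidable-stable; ¬¬-excluded-middle)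
open import Relation.Nullary.Negation using (¬¬-Monad; ¬¬-map)
open import Relation.Unary using (Pred; Decidable)

open RawMonad (¬¬-Monad {a = 0ℓ}) using (pure; _<$>_; _>>=_)

does≡true⇔ : ∀ {A : Set} (a? : Dec A) → does a? ≡ true ⇔ A
does≡true⇔ (yes a) = mk⇔ (λ _ → a) (λ _ → refl)
does≡true⇔ (no ¬a) = mk⇔ (λ ()) (λ a → contradiction a ¬a)

-- The Cantor walk (0,0), (1,0), (0,1), (2,0), (1,1), (0,2), … through ℕ × ℕ.
next : ℕ × ℕ → ℕ × ℕ
next (zero , b)  = suc b , zero
next (suc a , b) = a , suc b

unpair : ℕ → ℕ × ℕ
unpair zero    = zero , zero
unpair (suc n) = next (unpair n)

next-injective : ∀ {p q} → next p ≡ next q → p ≡ q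
next-injective {zero , _}  {zero , _}  refl = refl
next-injective {suc _ , _} {suc _ , _} refl = refl
next-injective {zero , _}  {suc _ , _} ()
next-injective {suc _ , _} {zero , _}  ()

next≢origin : ∀ p → next p ≢ (zero , zero)
next≢origin (zero , _)  ()
next≢origin (suc _ , _) ()

unpair-injective : ∀ {m n} → unpair m ≡ unpair n → m ≡ n
unpair-injective {zero}  {zero}  _  = refl
unpair-injective {zero}  {suc n} eq = contradiction (≡.sym eq) (next≢origin (unpair n))
unpair-injective {suc m} {zero}  eq = contradiction eq (next≢origin (unpair m))
unpair-injective {suc m} {suc n} eq = cong suc (unpair-injective (next-injective eq))

unpair-surjective : ∀ p → ∃ λ n → unpair n ≡ p
unpair-surjective (a , b) = onDiagonal (a + b) a b refl
  where
  onDiagonal : ∀ d a b → a + b ≡ d → ∃ λ n → unpair n ≡ (a , b)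
  onDiagonal d       a       (suc b) eq =
    Prod.map suc (cong next) (onDiagonal d (suc a) b (trans (≡.sym (+-suc a b)) eq))
  onDiagonal (suc d) (suc a) zero    eq =
    Prod.map suc (cong next) (onDiagonal d zero a (trans (≡.sym (+-identityʳ a)) (suc-injective eq)))
  onDiagonal zero    zero    zero    _  = zero , refl
  onDiagonal zero    (suc _) zero    ()
  onDiagonal (suc _) zero    zero    ()

Least : Pred ℕ 0ℓ → Pred ℕ 0ℓ
Least P n = P n × (∀ {m} → m < n → ¬ P m)

module _ {P : Pred ℕ 0ℓ} where

  least? : Decidable P → Decidable (Least P)
  least? P? n = P? n ×-dec allUpTo? (¬? ∘ P?) n

  least-unique : ∀ {m n} → Least P m → Least P n → m ≡ n
  least-unique {m} {n} (pm , below-m) (pn , below-n) with <-cmp m n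
  ... | tri< m<n _ _ = contradiction pm (below-n m<n)
  ... | tri≈ _ m≡n _ = m≡n
  ... | tri> _ _ n<m = contradiction pn (below-m n<m)

  least-exists : Decidable P → ∀ {n} → P n → ∃ (Least P)
  least-exists P? {n} = <-rec (λ n → P n → ∃ (Least P)) search n
    where
    search : ∀ n → (∀ {m} → m < n → P m → ∃ (Least P)) → P n → ∃ (Least P)
    search n smaller pn with anyUpTo? P? n
    ... | yes (m , m<n , pm) = smaller m<n pm
    ... | no none            = n , pn , λ m<n pm → none (_ , m<n , pm)

module Ranking (P : Pred ℕ 0ℓ) where

  data Count : ℕ → ℕ → Set where
    empty : Count zero zero
    hit   : ∀ {n k} → P n → Count n k → Count (suc n) (suc k)
    miss  : ∀ {n k} → ¬ P n → Count n k → Count (suc n) k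

  count-functional : ∀ {n k k′} → Count n k → Count n k′ → k ≡ k′
  count-functional empty       empty       = refl
  count-functional (hit _ c)   (hit _ c′)  = cong suc (count-functional c c′)
  count-functional (hit p _)   (miss ¬p _) = contradiction p ¬p
  count-functional (miss ¬p _) (hit p _)   = contradiction p ¬p
  count-functional (miss _ c)  (miss _ c′) = count-functional c c′

  count-mono-≤ : ∀ {m n j k} → m ≤ n → Count m j → Count n k → j ≤ k
  count-mono-≤ m≤n = go (≤⇒≤′ m≤n)
    where
    go : ∀ {m n j k} → m ≤′ n → Count m j → Count n k → j ≤ k
    go ≤′-refl        cm cn          = ≤-reflexive (count-functional cm cn)
    go (≤′-step m≤′n) cm (hit _ cn)  = m≤n⇒m≤1+n (go m≤′n cm cn)
    go (≤′-step m≤′n) cm (miss _ cn) = go m≤′n cm cn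

  count-total : ∀ n → ¬ ¬ ∃ (Count n)
  count-total zero    = pure (zero , empty)
  count-total (suc n) = do
    k , c ← count-total n
    p? ← ¬¬-excluded-middle
    pure (extend p? c)
    where
    extend : ∀ {k} → Dec (P n) → Count n k → ∃ (Count (suc n))
    extend (yes p) c = _ , hit p c
    extend (no ¬p) c = _ , miss ¬p c

  Rank : ℕ → ℕ → Set
  Rank x k = P x × Count x k

  rank-total : ∀ {x} → P x → ¬ ¬ ∃ (Rank x)
  rank-total p = Prod.map₂ (p ,_) <$> count-total _

  rank-functional : ∀ {x k l} → Rank x k → Rank x l → k ≡ l
  rank-functional (_ , c) (_ , c′) = count-functional c c′

  rank-mono-< : ∀ {x y k l} → x < y → Rank x k → Rank y l → k < l
  rank-mono-< x<y (p , c) (_ , c′) = count-mono-≤ x<y (hit p c) c′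

  rank-injective : ∀ {x y k} → Rank x k → Rank y k → x ≡ y
  rank-injective {x} {y} r r′ with <-cmp x y
  ... | tri< x<y _ _ = contradiction (rank-mono-< x<y r r′) (<-irrefl refl)
  ... | tri≈ _ x≡y _ = x≡y
  ... | tri> _ _ y<x = contradiction (rank-mono-< y<x r′ r) (<-irrefl refl)

  rank-≢⇔ : ∀ {x y k l} → Rank x k → Rank y l → x ≢ y ⇔ k ≢ l
  rank-≢⇔ {x} {y} {k} {l} r r′ = mk⇔
    (λ x≢y k≡l → x≢y (rank-injective r (subst (Rank y) (≡.sym k≡l) r′)))
    (λ k≢l x≡y → k≢l (rank-functional r (subst (λ z → Rank z l) (≡.sym x≡y) r′)))

  count⇒rank : ∀ {n m k} → Count n m → k < m → ∃ λ x → Rank x k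
  count⇒rank (hit {n} p c) k<1+m with m<1+n⇒m<n∨m≡n k<1+m
  ... | inj₁ k<m  = count⇒rank c k<m
  ... | inj₂ refl = n , p , c
  count⇒rank (miss _ c) k<m = count⇒rank c k<m

  count-unbounded : Inf P → ∀ k → ¬ ¬ ∃₂ λ n m → k ≤ m × Count n m
  count-unbounded _   zero    = pure (zero , zero , z≤n , empty)
  count-unbounded inf (suc k) = do
    n , m , k≤m , c ← count-unbounded inf k
    j , p ← witness (up n inf)
    l , c′ ← count-total (n + j)
    pure (_ , _ , s≤s (≤-trans k≤m (count-mono-≤ (m≤m+n n j) c c′)) , hit p c′)

  record DecidableRanks : Set₁ where
    field
      IsRank      : Pred ℕ 0ℓ
      isRank?     : Decidable IsRank
      rank⇒IsRank : ∀ {x k} → Rank x k → IsRank k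
      IsRank⇒rank : ∀ {k} → IsRank k → ¬ ¬ ∃ λ x → Rank x k

  finite-ranks : ∀ {i m} → (∀ j → i ≤ j → ¬ P j) → Count i m → DecidableRanks
  finite-ranks {i} {m} beyond c = record
    { IsRank      = _< m
    ; isRank?     = _<? m
    ; rank⇒IsRank = λ { (p , cx) → count-mono-≤ (≰⇒> (λ i≤x → beyond _ i≤x p)) (hit p cx) c }
    ; IsRank⇒rank = λ k<m → pure (count⇒rank c k<m)
    }

  infinite-ranks : Inf P → DecidableRanks
  infinite-ranks inf = record
    { IsRank      = λ _ → ⊤
    ; isRank?     = λ _ → yes tt
    ; rank⇒IsRank = λ _ → tt
    ; IsRank⇒rank = λ {k} _ → do
        _ , _ , k<m , c ← count-unbounded inf (suc k)
        pure (count⇒rank c k<m)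
    }

  decidable-ranks : ¬ ¬ DecidableRanks
  decidable-ranks ¬ranks = ¬¬-excluded-middle {A = Fin P} λ where
    (yes (i , beyond)) → count-total i λ (_ , c) → ¬ranks (finite-ranks beyond c)
    (no inf)           → ¬ranks (infinite-ranks inf)

open Ranking using (Rank; DecidableRanks; decidable-ranks)

adj? : ∀ G x y → Dec (Adj G x y)
adj? G x y = E G x y Bool.≟ true

NonNeighbour : CompGraph → ℕ → ℕ → Set
NonNeighbour G x y = y ∈V G × y ≢ x × ¬ Adj G x y

module Neighbours (G : CompGraph) where

  nonNeighbour? : ∀ x → Decidable (NonNeighbour G x)
  nonNeighbour? x y = (V G y Bool.≟ true) ×-dec ¬? (y ≟ x) ×-dec ¬? (adj? G x y)

  nonNeighbour⇒¬universal : ∀ {x y} → NonNeighbour G x y → ¬ Universal G x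
  nonNeighbour⇒¬universal (y∈G , y≢x , ¬adj) (_ , adjacent) = ¬adj (adjacent _ y∈G y≢x)

  ¬universal⇒nonNeighbour : ∀ {x} → x ∈V G → ¬ Universal G x → ¬ ¬ ∃ (NonNeighbour G x)
  ¬universal⇒nonNeighbour {x} x∈G ¬u none = ¬u (x∈G , adjacent)
    where
    adjacent : ∀ y → y ∈V G → y ≢ x → Adj G x y
    adjacent y y∈G y≢x = decidable-stable (adj? G x y) λ ¬adj → none (y , y∈G , y≢x , ¬adj)

  universal-adj : ∀ {x y} → Universal G x → y ∈V G → ¬ Universal G y → Adj G x y
  universal-adj u@(_ , adjacent) y∈G ¬u = adjacent _ y∈G λ { refl → ¬u u }

  universal-adj⇔≢ : ∀ {x y} → Universal G x → y ∈V G → Adj G x y ⇔ x ≢ y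
  universal-adj⇔≢ {x} (_ , adjacent) y∈G = mk⇔ adj⇒≢ (adjacent _ y∈G ∘ ≢-sym)
    where
    adj⇒≢ : ∀ {y} → Adj G x y → x ≢ y
    adj⇒≢ adj refl with () ← trans (≡.sym adj) (irrefl G x)

-- R is only classically total, but adjacency in G is decidable, hence ¬¬-stable.
iso-reflects-universal : ∀ {G H R} → IsIso G H R →
                         ∀ {x y} → R x y → Universal H y → Universal G x
iso-reflects-universal {G} {H} {R} iso {x} {y} rxy (_ , adjacentH) = proj₁ (dom rxy) , adjacent
  where
  open IsIso iso
  adjacent : ∀ z → z ∈V G → z ≢ x → Adj G x z
  adjacent z z∈G z≢x = decidable-stable (adj? G x z) λ ¬adj → total z z∈G λ (w , rzw) →
    let w≢y = λ w≡y → z≢x (injective (subst (R z) w≡y rzw) rxy)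
    in ¬adj (Equivalence.from (preserves rxy rzw) (adjacentH w (proj₂ (dom rzw)) w≢y))

module Copy (G : CompGraph) (ranks : DecidableRanks (Universal G)) where

  open Neighbours G
  open Ranking (Universal G) using (rank-functional; rank-injective; rank-≢⇔; rank-total)
  open DecidableRanks ranks

  -- (zero , k) codes the k-th vertex of a clique standing for the universal
  -- vertices; (suc x , s) codes the vertex x, whose least non-neighbour is s.
  IsVertexCode : ℕ × ℕ → Set
  IsVertexCode (zero , k)  = IsRank k
  IsVertexCode (suc x , s) = x ∈V G × Least (NonNeighbour G x) s

  isVertexCode? : Decidable IsVertexCode
  isVertexCode? (zero , k)  = isRank? k
  isVertexCode? (suc x , s) = (V G x Bool.≟ true) ×-dec least? (nonNeighbour? x) s

  adjacentCodes : ℕ × ℕ → ℕ × ℕ → Bool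
  adjacentCodes (zero , k)  (zero , k′)  = does (¬? (k ≟ k′))
  adjacentCodes (zero , _)  (suc _ , _)  = true
  adjacentCodes (suc _ , _) (zero , _)   = true
  adjacentCodes (suc x , _) (suc x′ , _) = E G x x′

  adjacentCodes-irrefl : ∀ c → adjacentCodes c c ≡ false
  adjacentCodes-irrefl (zero , k)  = dec-false (¬? (k ≟ k)) (λ k≢k → k≢k refl)
  adjacentCodes-irrefl (suc x , _) = irrefl G x

  adjacentCodes-sym : ∀ c c′ → adjacentCodes c c′ ≡ adjacentCodes c′ c
  adjacentCodes-sym (zero , k)  (zero , k′)  = does-⇔ (mk⇔ ≢-sym ≢-sym) (¬? (k ≟ k′)) (¬? (k′ ≟ k))
  adjacentCodes-sym (zero , _)  (suc _ , _)  = refl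
  adjacentCodes-sym (suc _ , _) (zero , _)   = refl
  adjacentCodes-sym (suc x , _) (suc x′ , _) = sym G x x′

  clique-adjacent : ∀ k c → c ≢ (zero , k) → adjacentCodes (zero , k) c ≡ true
  clique-adjacent k (zero , k′) c≢k = dec-true (¬? (k ≟ k′)) λ { refl → c≢k refl }
  clique-adjacent k (suc _ , _) _   = refl

  H : CompGraph
  H = record
    { V      = does ∘ isVertexCode? ∘ unpair
    ; E      = λ m n → adjacentCodes (unpair m) (unpair n)
    ; irrefl = adjacentCodes-irrefl ∘ unpair
    ; sym    = λ m n → adjacentCodes-sym (unpair m) (unpair n)
    }

  ∈H⇔ : ∀ n {c} → unpair n ≡ c → n ∈V H ⇔ IsVertexCode c
  ∈H⇔ n refl = does≡true⇔ (isVertexCode? (unpair n))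

  data Represents : ℕ → ℕ × ℕ → Set where
    clique : ∀ {x k} → Rank (Universal G) x k → Represents x (zero , k)
    copy   : ∀ {x s} → x ∈V G → Least (NonNeighbour G x) s → Represents x (suc x , s)

  represents-dom : ∀ {x c} → Represents x c → x ∈V G × IsVertexCode c
  represents-dom (clique r@((x∈G , _) , _)) = x∈G , rank⇒IsRank r
  represents-dom (copy x∈G least)           = x∈G , x∈G , least

  represents-functional : ∀ {x c c′} → Represents x c → Represents x c′ → c ≡ c′
  represents-functional (clique r)        (clique r′)       = cong (zero ,_) (rank-functional r r′)
  represents-functional (clique (u , _))  (copy _ (nn , _)) = contradiction u (nonNeighbour⇒¬universal nn)
  represents-functional (copy _ (nn , _)) (clique (u , _))  = contradiction u (nonNeighbour⇒¬universal nn)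
  represents-functional (copy _ least)    (copy _ least′)   = cong (suc _ ,_) (least-unique least least′)

  represents-injective : ∀ {x x′ c} → Represents x c → Represents x′ c → x ≡ x′
  represents-injective (clique r) (clique r′) = rank-injective r r′
  represents-injective (copy _ _) (copy _ _)  = refl

  represents-total : ∀ {x} → x ∈V G → ¬ ¬ ∃ (Represents x)
  represents-total {x} x∈G = ¬¬-excluded-middle >>= λ where
    (yes u) → (λ (k , r) → (zero , k) , clique r) <$> rank-total u
    (no ¬u) → do
      _ , nn ← ¬universal⇒nonNeighbour x∈G ¬u
      let s , least = least-exists (nonNeighbour? x) nn
      pure ((suc x , s) , copy x∈G least)

  represents-surjective : ∀ {c} → IsVertexCode c → ¬ ¬ ∃ λ x → Represents x c
  represents-surjective {zero , _}  k∈ranks       = Prod.map₂ clique <$> IsRank⇒rank k∈ranks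
  represents-surjective {suc x , _} (x∈G , least) = pure (x , copy x∈G least)

  represents-preserves : ∀ {x x′ c c′} → Represents x c → Represents x′ c′ →
                         Adj G x x′ ⇔ (adjacentCodes c c′ ≡ true)
  represents-preserves {x} {x′} (clique {k = k} r@(u , _)) (clique {k = k′} r′@((x′∈G , _) , _)) =
    begin
      Adj G x x′                            ≈⟨ universal-adj⇔≢ u x′∈G ⟩
      x ≢ x′                                ≈⟨ rank-≢⇔ r r′ ⟩
      k ≢ k′                                ≈⟨ ⇔-sym (does≡true⇔ (¬? (k ≟ k′))) ⟩
      adjacentCodes (zero , k) (zero , k′) ≡ true ∎
    where open import Relation.Binary.Reasoning.Setoid (⇔-setoid 0ℓ)
  represents-preserves (clique (u , _)) (copy x′∈G (nn , _)) =
    mk⇔ (λ _ → refl) λ _ → universal-adj u x′∈G (nonNeighbour⇒¬universal nn)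
  represents-preserves (copy x∈G (nn , _)) (clique (u′ , _)) =
    mk⇔ (λ _ → refl) λ _ → trans (sym G _ _) (universal-adj u′ x∈G (nonNeighbour⇒¬universal nn))
  represents-preserves (copy _ _) (copy _ _) = mk⇔ (λ adj → adj) (λ adj → adj)

  R : ℕ → ℕ → Set
  R x n = Represents x (unpair n)

  H-iso : IsIso G H R
  H-iso = record
    { dom        = λ {_} {n} → Prod.map₂ (Equivalence.from (∈H⇔ n refl)) ∘ represents-dom
    ; functional = λ r r′ → unpair-injective (represents-functional r r′)
    ; injective  = represents-injective
    ; total      = λ _ x∈G → Prod.uncurry vertexOf <$> represents-total x∈G
    ; surjective = λ n n∈H → represents-surjective (Equivalence.to (∈H⇔ n refl) n∈H)
    ; preserves  = represents-preserves
    }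
    where
    vertexOf : ∀ {x} c → Represents x c → ∃ (R x)
    vertexOf {x} c r = Prod.map₂ (λ eq → subst (Represents x) (≡.sym eq) r) (unpair-surjective c)

  isClique : ℕ × ℕ → Bool
  isClique (zero , k)  = does (isRank? k)
  isClique (suc _ , _) = false

  clique⇒universal : ∀ {n} c → unpair n ≡ c → isClique c ≡ true → Universal H n
  clique⇒universal {n} (zero , k) eq isRank≡true =
    Equivalence.from (∈H⇔ n eq) (Equivalence.to (does≡true⇔ (isRank? k)) isRank≡true) ,
    λ m _ m≢n → subst (λ c → adjacentCodes c (unpair m) ≡ true) (≡.sym eq)
      (clique-adjacent k (unpair m) (λ eq′ → m≢n (unpair-injective (trans eq′ (≡.sym eq)))))

  universal⇒clique : ∀ {n} c → unpair n ≡ c → Universal H n → isClique c ≡ true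
  universal⇒clique {n} (zero , k) eq (n∈H , _) =
    dec-true (isRank? k) (Equivalence.to (∈H⇔ n eq) n∈H)
  universal⇒clique {n} (suc x , _) eq u@(n∈H , _) =
    let x∈G , least = Equivalence.to (∈H⇔ n eq) n∈H
    in contradiction (iso-reflects-universal H-iso (subst (Represents x) (≡.sym eq) (copy x∈G least)) u)
                     (nonNeighbour⇒¬universal (proj₁ least))

  universal-computable : UniversalComputable H
  universal-computable =
    isClique ∘ unpair , λ _ → mk⇔ (clique⇒universal _ refl) (universal⇒clique _ refl)

corollary3p4 : (G : CompGraph) → HasCopyWithComputableUniversal G
corollary3p4 G = ¬¬-map copyOf (decidable-ranks (Universal G))
  where
  copyOf : DecidableRanks (Universal G) →
           Σ CompGraph λ H → Σ (ℕ → ℕ → Set) λ R → IsIso G H R × UniversalComputable H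
  copyOf ranks = H , R , H-iso , universal-computable
    where open Copy G ranks
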